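{- Let $\gamma \geq 0$ be an integer and $\mathcal{M}$ be a unital $\gamma$-multiprojection algebra of height $h$, with unit $\mathbf{1}$ and endomorphisms $\pi_a$, $a \in [\gamma]$. Let $\mathrm{M}(\mathcal{M})$ be the associated $\gamma$-pluriassociative algebra. Then (i) for any $a \in [h]$, $\mathbf{1}$ is an $a$-bar-unit of $\mathrm{M}(\mathcal{M})$; (ii) for any $a \leq b \in [h]$, $\mathrm{Halo}_a(\mathrm{M}(\mathcal{M}))$ is a subset of $\mathrm{Halo}_b(\mathrm{M}(\mathcal{M}))$; (iii) for any $a \in [h]$, the linear span of $\mathrm{Halo}_a(\mathrm{M}(\mathcal{M}))$ forms an $(h-a+1)$-pluriassociative subalgebra of the $(h-a+1)$-pluriassociative subalgebra of $\mathrm{M}(\mathcal{M})$ induced by $\{a, a+1, \dots, h\}$; (iv) for any $a \in [h]$, $\pi_a$ is the identity map if and only if $\mathbf{1}$ is an $a$-wire-unit of $\mathrm{M}(\mathcal{M})$.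
   Context: The ground field has characteristic zero; $[n]=\{1,\dots,n\}$ and $a \uparrow a' := \max(a,a')$. A $\gamma$-multiassociative algebra is a vector space $\mathcal{M}$ with bilinear operations $\star_a$, $a \in [\gamma]$, such that for all $x,y,z \in \mathcal{M}$, all $b \in [\gamma]$ and all $a, a', a'', a''' \in [\gamma]$ that are $\leq b$: $(x \star_a y) \star_b z = (x \star_b y) \star_{a'} z = x \star_{a''} (y \star_b z) = x \star_b (y \star_{a'''} z)$. An $a$-unit of $\mathcal{M}$ is an element $\mathbf{1}$ with $\mathbf{1} \star_a x = x = x \star_a \mathbf{1}$ for all $x$; a unit is an $a$-unit for some $a \in [\gamma]$. If there is a unit, it is unique, and a $b$-unit is also an $a$-unit for all $a \le b$. The height of $\mathcal{M}$ is $0$ if it has no unit, and otherwise the greatest $h \in [\gamma]$ such that its unit is an $h$-unit. A $\gamma$-multiprojection algebra is a $\gamma$-multiassociative algebra $\mathcal{M}$ endowed with endomorphisms $\pi_a$, $a \in [\gamma]$ (linear maps commuting with all $\star_c$), satisfying $\pi_a \circ \pi_{a'} = \pi_{a \uparrow a'}$ for all $a, a' \in [\gamma]$. Its height is its height as a $\gamma$-multiassociative algebra. It is unital if it has a unit $\mathbf{1}$ (as a $\gamma$-multiassociative algebra) and $\pi_a(\mathbf{1}) = \mathbf{1}$ for all $a \in [h]$, $h$ being its height. A $\gamma$-pluriassociative algebra is a vector space with bilinear operations $\dashv_a, \vdash_a$, $a \in [\gamma]$, such that for all elements $x,y,z$ and all $a, a' \in [\gamma]$: $(x \vdash_{a'}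 y) \dashv_a z = x \vdash_{a'} (y \dashv_a z)$; $(x \dashv_{a\uparrow a'} y) \dashv_a z = x \dashv_a (y \vdash_{a'} z)$; $(x \dashv_{a'} y) \vdash_a z = x \vdash_a (y \vdash_{a \uparrow a'} z)$; $(x \dashv_a y) \dashv_{a\uparrow a'} z = x \dashv_a (y \dashv_{a'} z)$; $(x \vdash_{a'} y) \vdash_a z = x \vdash_{a \uparrow a'} (y \vdash_a z)$. $\mathrm{M}(\mathcal{M})$ is the vector space $\mathcal{M}$ with $x \dashv_a y := x \star_a \pi_a(y)$ and $x \vdash_a y := \pi_a(x) \star_a y$; it is a $\gamma$-pluriassociative algebra. In a $\gamma$-pluriassociative algebra $\mathcal{P}$, an element $e$ is an $a$-bar-unit if $x \dashv_a e = x = e \vdash_a x$ for all $x$, and an $a$-wire-unit if $e \dashv_a x = x = x \vdash_a e$ for all $x$. $\mathrm{Halo}_a(\mathcal{P})$ is the set of $a$-bar-units of $\mathcal{P}$. For $C \subseteq [\gamma]$, the $\#C$-pluriassociative subalgebra of $\mathcal{P}$ induced by $C$ is the vector space $\mathcal{P}$ keeping only the operations $\dashv_c, \vdash_c$ with $c \in C$, renumbered from $1$ to $\#C$ in increasing order. A subalgebra is a subspace stable under all the operations. -}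

module Defs where

open import Level using (Level; _⊔_) renaming (suc to lsuc)
open import Algebra.Apartness.Bundles using (HeytingField; module HeytingCommutativeRing)
open import Algebra.Bundles using (CommutativeRing)
open import Algebra.Core using (Op₂)
open import Algebra.Definitions using (Congruent₂)
import Algebra.Definitions.RawMonoid as RawMonoidDefinitions
import Algebra.Construct.NaturalChoice.Max as Max
open import Algebra.Module.Bundles using (Module)
open import Algebra.Module.Morphism.Structures using (module ModuleMorphisms)
import Algebra.Module.Morphism.Construct.Composition as Composition
open import Data.Bool.Base using (true; false)
open import Data.Fin.Base using (Fin; zero; suc; toℕ; _≤_)
open import Data.Fin.Properties using (≤-totalOrder; ≤-total)
open import Data.Fin.Subset using (Subset; ∣_∣)
open import Data.Nat.Base as ℕ using (ℕ; z≤n; s≤s)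
import Data.Nat.Properties as ℕ
open import Data.Product.Base using (∃-syntax; Σ-syntax; _×_)
open import Data.Sum.Base using (inj₁; inj₂)
open import Data.Vec.Base using (_∷_; tabulate)
open import Data.Vec.Functional using (Vector)
open import Relation.Binary.Definitions using (_Respects_)
open import Relation.Binary.PropositionalEquality as ≡ using (_≡_)
import Relation.Binary.Reasoning.Setoid as SetoidReasoning
open import Relation.Nullary.Decidable using (does; _×-dec_)
open import Relation.Nullary.Negation using (¬_)
open import Relation.Unary using (Pred)

private
  variable
    c ℓ₁ ℓ₂ m ℓm p : Level
    γ : ℕ

-- The index set [γ] = {1, …, γ} is represented by Fin γ, the number
-- a ∈ [γ] corresponding to the i : Fin γ with index i = a.

index : Fin γ → ℕ
index i = ℕ.suc (toℕ i)

infixl 6 _↑_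

_↑_ : Op₂ (Fin γ)
_↑_ {γ} = Max._⊔_ (≤-totalOrder γ)

≤⇒↑≡ʳ : {a b : Fin γ} → a ≤ b → a ↑ b ≡ b
≤⇒↑≡ʳ {γ} = Max.x≤y⇒x⊔y≈y (≤-totalOrder γ)

≤⇒↑≡ˡ : {a b : Fin γ} → b ≤ a → a ↑ b ≡ a
≤⇒↑≡ˡ {γ} = Max.x≤y⇒y⊔x≈y (≤-totalOrder γ)

module _ (K : HeytingField c ℓ₁ ℓ₂) where

  open HeytingField K
  open HeytingCommutativeRing heytingCommutativeRing using (commutativeRing)

  CharacteristicZero : Set ℓ₁
  CharacteristicZero = ∀ n → ¬ (ℕ.suc n ×ᴷ 1# ≈ 0#)
    where
    open RawMonoidDefinitions
           (CommutativeRing.+-rawMonoid commutativeRing)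
           renaming (_×_ to _×ᴷ_)

  VectorSpace : (m ℓm : Level) → Set _
  VectorSpace = Module commutativeRing

module _ {R : CommutativeRing c ℓ₁} (V : Module R m ℓm) where

  open CommutativeRing R using (Carrier)
  open Module V
  open RawMonoidDefinitions +ᴹ-rawMonoid using (sum)

  IsLinear : (Carrierᴹ → Carrierᴹ) → Set _
  IsLinear = ModuleMorphisms.IsModuleHomomorphism rawModule rawModule

  record IsBilinear (_∙_ : Op₂ Carrierᴹ) : Set (c ⊔ m ⊔ ℓm) where
    field
      ∙-cong  : Congruent₂ _≈ᴹ_ _∙_
      linearˡ : ∀ y → IsLinear (_∙ y)
      linearʳ : ∀ x → IsLinear (x ∙_)

  record IsSubspace (S : Pred Carrierᴹ p) : Set (c ⊔ m ⊔ ℓm ⊔ p) where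
    field
      resp-≈ : S Respects _≈ᴹ_
      0ᴹ∈    : S 0ᴹ
      +ᴹ∈    : ∀ {x y} → S x → S y → S (x +ᴹ y)
      *ₗ∈    : ∀ k {x} → S x → S (k *ₗ x)

  Span : Pred Carrierᴹ p → Pred Carrierᴹ (c ⊔ m ⊔ ℓm ⊔ p)
  Span S x =
    Σ[ n ∈ ℕ ] Σ[ k ∈ Vector Carrier n ] Σ[ v ∈ Vector Carrierᴹ n ]
      (∀ i → S (v i)) × x ≈ᴹ sum (λ i → k i *ₗ v i)

record MultiassociativeAlgebra
  (K : HeytingField c ℓ₁ ℓ₂) (γ : ℕ) (m ℓm : Level)
  : Set (c ⊔ ℓ₁ ⊔ lsuc (m ⊔ ℓm)) where

  infixl 7 _⋆[_]_

  field
    vectorSpace : VectorSpace K m ℓm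

  open Module vectorSpace public

  field
    _⋆[_]_     : Carrierᴹ → Fin γ → Carrierᴹ → Carrierᴹ
    ⋆-bilinear : ∀ a → IsBilinear vectorSpace (λ x y → x ⋆[ a ] y)

    -- The three consecutive equalities of
    -- (x ⋆ₐ y) ⋆_b z = (x ⋆_b y) ⋆ₐ′ z = x ⋆ₐ″ (y ⋆_b z) = x ⋆_b (y ⋆ₐ‴ z).
    ⋆-assoc₁ : ∀ {a a′ b} → a ≤ b → a′ ≤ b → ∀ x y z →
               (x ⋆[ a ] y) ⋆[ b ] z ≈ᴹ (x ⋆[ b ] y) ⋆[ a′ ] z
    ⋆-assoc₂ : ∀ {a′ a″ b} → a′ ≤ b → a″ ≤ b → ∀ x y z →
               (x ⋆[ b ] y) ⋆[ a′ ] z ≈ᴹ x ⋆[ a″ ] (y ⋆[ b ] z)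
    ⋆-assoc₃ : ∀ {a″ a‴ b} → a″ ≤ b → a‴ ≤ b → ∀ x y z →
               x ⋆[ a″ ] (y ⋆[ b ] z) ≈ᴹ x ⋆[ b ] (y ⋆[ a‴ ] z)

  ⋆-cong : ∀ a {x x′ y y′} → x ≈ᴹ x′ → y ≈ᴹ y′ → x ⋆[ a ] y ≈ᴹ x′ ⋆[ a ] y′
  ⋆-cong a = IsBilinear.∙-cong (⋆-bilinear a)

  IsUnitAt : Fin γ → Pred Carrierᴹ (m ⊔ ℓm)
  IsUnitAt a e = ∀ x → e ⋆[ a ] x ≈ᴹ x × x ⋆[ a ] e ≈ᴹ x

  IsUnit : Pred Carrierᴹ (m ⊔ ℓm)
  IsUnit e = ∃[ a ] IsUnitAt a e

  -- A relation rather than a function, as the existence of a unit need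
  -- not be decidable.
  data HasHeight : ℕ → Set (m ⊔ ℓm) where
    no-unit : (∀ e → ¬ IsUnit e) → HasHeight 0
    unit    : ∀ {e} h → IsUnitAt h e → (∀ a → IsUnitAt a e → a ≤ h) →
              HasHeight (index h)

record MultiprojectionAlgebra
  (K : HeytingField c ℓ₁ ℓ₂) (γ : ℕ) (m ℓm : Level)
  : Set (c ⊔ ℓ₁ ⊔ lsuc (m ⊔ ℓm)) where

  field
    multiassociativeAlgebra : MultiassociativeAlgebra K γ m ℓm

  open MultiassociativeAlgebra multiassociativeAlgebra public

  field
    π        : Fin γ → Carrierᴹ → Carrierᴹ
    π-linear : ∀ a → IsLinear vectorSpace (π a)
    π-⋆      : ∀ a b x y → π a (x ⋆[ b ] y) ≈ᴹ π a x ⋆[ b ] π a y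
    π-∘      : ∀ a a′ x → π a (π a′ x) ≈ᴹ π (a ↑ a′) x

  record IsUnital (h : ℕ) (𝟏 : Carrierᴹ) : Set (m ⊔ ℓm) where
    field
      hasHeight : HasHeight h
      isUnit    : IsUnit 𝟏
      π-unit    : ∀ a → index a ℕ.≤ h → π a 𝟏 ≈ᴹ 𝟏

record PluriassociativeAlgebra
  (K : HeytingField c ℓ₁ ℓ₂) (γ : ℕ) (m ℓm : Level)
  : Set (c ⊔ ℓ₁ ⊔ lsuc (m ⊔ ℓm)) where

  infixl 7 _⊣[_]_ _⊢[_]_

  field
    vectorSpace : VectorSpace K m ℓm

  open Module vectorSpace public

  field
    _⊣[_]_ _⊢[_]_ : Carrierᴹ → Fin γ → Carrierᴹ → Carrierᴹ
    ⊣-bilinear    : ∀ a → IsBilinear vectorSpace (λ x y → x ⊣[ a ] y)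
    ⊢-bilinear    : ∀ a → IsBilinear vectorSpace (λ x y → x ⊢[ a ] y)

    ⊢-⊣ : ∀ a a′ x y z →
          (x ⊢[ a′ ] y) ⊣[ a ] z ≈ᴹ x ⊢[ a′ ] (y ⊣[ a ] z)
    ⊣-⊢ : ∀ a a′ x y z →
          (x ⊣[ a ↑ a′ ] y) ⊣[ a ] z ≈ᴹ x ⊣[ a ] (y ⊢[ a′ ] z)
    ⊢-↑ : ∀ a a′ x y z →
          (x ⊣[ a′ ] y) ⊢[ a ] z ≈ᴹ x ⊢[ a ] (y ⊢[ a ↑ a′ ] z)
    ⊣-⊣ : ∀ a a′ x y z →
          (x ⊣[ a ] y) ⊣[ a ↑ a′ ] z ≈ᴹ x ⊣[ a ] (y ⊣[ a′ ] z)
    ⊢-⊢ : ∀ a a′ x y z →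
          (x ⊢[ a′ ] y) ⊢[ a ] z ≈ᴹ x ⊢[ a ↑ a′ ] (y ⊢[ a ] z)

  IsBarUnit : Fin γ → Pred Carrierᴹ (m ⊔ ℓm)
  IsBarUnit a e = ∀ x → x ⊣[ a ] e ≈ᴹ x × e ⊢[ a ] x ≈ᴹ x

  IsWireUnit : Fin γ → Pred Carrierᴹ (m ⊔ ℓm)
  IsWireUnit a e = ∀ x → e ⊣[ a ] x ≈ᴹ x × x ⊢[ a ] e ≈ᴹ x

  Halo : Fin γ → Pred Carrierᴹ (m ⊔ ℓm)
  Halo = IsBarUnit

  record IsSubalgebra (S : Pred Carrierᴹ p) : Set (c ⊔ m ⊔ ℓm ⊔ p) where
    field
      isSubspace : IsSubspace vectorSpace S
      ⊣∈         : ∀ a {x y} → S x → S y → S (x ⊣[ a ] y)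
      ⊢∈         : ∀ a {x y} → S x → S y → S (x ⊢[ a ] y)

-- The increasing enumeration of the elements of C.
enumerate : (C : Subset γ) → Fin ∣ C ∣ → Fin γ
enumerate (true  ∷ C) zero    = zero
enumerate (true  ∷ C) (suc i) = suc (enumerate C i)
enumerate (false ∷ C) i       = suc (enumerate C i)

enumerate-mono-≤ : (C : Subset γ) {i j : Fin ∣ C ∣} → i ≤ j →
                   enumerate C i ≤ enumerate C j
enumerate-mono-≤ (true  ∷ C) {zero}          i≤j       = z≤n
enumerate-mono-≤ (true  ∷ C) {suc i} {suc j} (s≤s i≤j) =
  s≤s (enumerate-mono-≤ C i≤j)
enumerate-mono-≤ (false ∷ C)                 i≤j       =
  s≤s (enumerate-mono-≤ C i≤j)

enumerate-↑ : (C : Subset γ) (i j : Fin ∣ C ∣) →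
              enumerate C (i ↑ j) ≡ enumerate C i ↑ enumerate C j
enumerate-↑ C i j with ≤-total i j
... | inj₁ i≤j = ≡.trans (≡.cong (enumerate C) (≤⇒↑≡ʳ i≤j))
                         (≡.sym (≤⇒↑≡ʳ (enumerate-mono-≤ C i≤j)))
... | inj₂ j≤i = ≡.trans (≡.cong (enumerate C) (≤⇒↑≡ˡ j≤i))
                         (≡.sym (≤⇒↑≡ˡ (enumerate-mono-≤ C j≤i)))

-- {a, …, b} ∩ [γ]
interval : ℕ → ℕ → Subset γ
interval a b = tabulate λ i → does ((a ℕ.≤? index i) ×-dec (index i ℕ.≤? b))

induced : {K : HeytingField c ℓ₁ ℓ₂} → PluriassociativeAlgebra K γ m ℓm →
          (C : Subset γ) → PluriassociativeAlgebra K ∣ C ∣ m ℓm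
induced 𝓟 C = record
  { vectorSpace = vectorSpace
  ; _⊣[_]_      = λ x i y → x ⊣[ # i ] y
  ; _⊢[_]_      = λ x i y → x ⊢[ # i ] y
  ; ⊣-bilinear  = λ i → ⊣-bilinear (# i)
  ; ⊢-bilinear  = λ i → ⊢-bilinear (# i)
  ; ⊢-⊣         = λ i j → ⊢-⊣ (# i) (# j)
  ; ⊣-⊢         = λ i j x y z → ≡.subst
      (λ k → (x ⊣[ k ] y) ⊣[ # i ] z ≈ᴹ x ⊣[ # i ] (y ⊢[ # j ] z))
      (≡.sym (enumerate-↑ C i j)) (⊣-⊢ (# i) (# j) x y z)
  ; ⊢-↑         = λ i j x y z → ≡.subst
      (λ k → (x ⊣[ # j ] y) ⊢[ # i ] z ≈ᴹ x ⊢[ # i ] (y ⊢[ k ] z))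
      (≡.sym (enumerate-↑ C i j)) (⊢-↑ (# i) (# j) x y z)
  ; ⊣-⊣         = λ i j x y z → ≡.subst
      (λ k → (x ⊣[ # i ] y) ⊣[ k ] z ≈ᴹ x ⊣[ # i ] (y ⊣[ # j ] z))
      (≡.sym (enumerate-↑ C i j)) (⊣-⊣ (# i) (# j) x y z)
  ; ⊢-⊢         = λ i j x y z → ≡.subst
      (λ k → (x ⊢[ # j ] y) ⊢[ # i ] z ≈ᴹ x ⊢[ k ] (y ⊢[ # i ] z))
      (≡.sym (enumerate-↑ C i j)) (⊢-⊢ (# i) (# j) x y z)
  }
  where
  open PluriassociativeAlgebra 𝓟

  # : Fin ∣ C ∣ → Fin _
  # = enumerate C

module _ {K : HeytingField c ℓ₁ ℓ₂} (𝓜 : MultiprojectionAlgebra K γ m ℓm) where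

  open MultiprojectionAlgebra 𝓜
  open SetoidReasoning ≈ᴹ-setoid

  private
    ≤-refl : {a : Fin γ} → a ≤ a
    ≤-refl = ℕ.≤-refl

    π-cong : ∀ a {x y} → x ≈ᴹ y → π a x ≈ᴹ π a y
    π-cong a = ModuleMorphisms.IsModuleHomomorphism.⟦⟧-cong (π-linear a)

    compose : ∀ {f g} → IsLinear vectorSpace f → IsLinear vectorSpace g →
              IsLinear vectorSpace (λ x → g (f x))
    compose = Composition.isModuleHomomorphism ≈ᴹ-trans

    assoc₁₃ : ∀ {a a″ b} → a ≤ b → a″ ≤ b → ∀ x y z →
              (x ⋆[ a ] y) ⋆[ b ] z ≈ᴹ x ⋆[ a″ ] (y ⋆[ b ] z)
    assoc₁₃ a≤b a″≤b x y z =
      ≈ᴹ-trans (⋆-assoc₁ a≤b a≤b x y z) (⋆-assoc₂ a≤b a″≤b x y z)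

    assoc₁₄ : ∀ {a a‴ b} → a ≤ b → a‴ ≤ b → ∀ x y z →
              (x ⋆[ a ] y) ⋆[ b ] z ≈ᴹ x ⋆[ b ] (y ⋆[ a‴ ] z)
    assoc₁₄ a≤b a‴≤b x y z =
      ≈ᴹ-trans (assoc₁₃ a≤b a≤b x y z) (⋆-assoc₃ a≤b a‴≤b x y z)

    assoc₂₄ : ∀ {a′ a‴ b} → a′ ≤ b → a‴ ≤ b → ∀ x y z →
              (x ⋆[ b ] y) ⋆[ a′ ] z ≈ᴹ x ⋆[ b ] (y ⋆[ a‴ ] z)
    assoc₂₄ a′≤b a‴≤b x y z =
      ≈ᴹ-trans (⋆-assoc₂ a′≤b a′≤b x y z) (⋆-assoc₃ a′≤b a‴≤b x y z)

    ⋆-⊢⊣ : ∀ a a′ x y z → (x ⋆[ a′ ] y) ⋆[ a ] z ≈ᴹ x ⋆[ a′ ] (y ⋆[ a ] z)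
    ⋆-⊢⊣ a a′ with ≤-total a a′
    ... | inj₁ a≤a′ = assoc₂₄ a≤a′ a≤a′
    ... | inj₂ a′≤a = assoc₁₃ a′≤a a′≤a

    ⋆-⊣⊢ : ∀ a a′ x y z →
           (x ⋆[ a ↑ a′ ] y) ⋆[ a ] z ≈ᴹ x ⋆[ a ] (y ⋆[ a′ ] z)
    ⋆-⊣⊢ a a′ with ≤-total a a′
    ... | inj₁ a≤a′ rewrite ≤⇒↑≡ʳ a≤a′ = ⋆-assoc₂ a≤a′ a≤a′
    ... | inj₂ a′≤a rewrite ≤⇒↑≡ˡ a′≤a = assoc₁₄ ≤-refl a′≤a

    ⋆-⊢↑ : ∀ a a′ x y z →
           (x ⋆[ a′ ] y) ⋆[ a ] z ≈ᴹ x ⋆[ a ] (y ⋆[ a ↑ a′ ] z)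
    ⋆-⊢↑ a a′ with ≤-total a a′
    ... | inj₁ a≤a′ rewrite ≤⇒↑≡ʳ a≤a′ = ⋆-assoc₂ a≤a′ a≤a′
    ... | inj₂ a′≤a rewrite ≤⇒↑≡ˡ a′≤a = assoc₁₄ a′≤a ≤-refl

    ⋆-⊣⊣ : ∀ a a′ x y z →
           (x ⋆[ a ] y) ⋆[ a ↑ a′ ] z ≈ᴹ x ⋆[ a ] (y ⋆[ a′ ] z)
    ⋆-⊣⊣ a a′ with ≤-total a a′
    ... | inj₁ a≤a′ rewrite ≤⇒↑≡ʳ a≤a′ = assoc₁₃ a≤a′ a≤a′
    ... | inj₂ a′≤a rewrite ≤⇒↑≡ˡ a′≤a = assoc₁₄ ≤-refl a′≤a

    ⋆-⊢⊢ : ∀ a a′ x y z →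
           (x ⋆[ a′ ] y) ⋆[ a ] z ≈ᴹ x ⋆[ a ↑ a′ ] (y ⋆[ a ] z)
    ⋆-⊢⊢ a a′ with ≤-total a a′
    ... | inj₁ a≤a′ rewrite ≤⇒↑≡ʳ a≤a′ = assoc₂₄ a≤a′ a≤a′
    ... | inj₂ a′≤a rewrite ≤⇒↑≡ˡ a′≤a = assoc₁₄ a′≤a ≤-refl

  M : PluriassociativeAlgebra K γ m ℓm
  M = record
    { vectorSpace = vectorSpace
    ; _⊣[_]_      = λ x a y → x ⋆[ a ] π a y
    ; _⊢[_]_      = λ x a y → π a x ⋆[ a ] y
    ; ⊣-bilinear  = λ a → let open IsBilinear (⋆-bilinear a) in record
      { ∙-cong  = λ x≈x′ y≈y′ → ∙-cong x≈x′ (π-cong a y≈y′)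
      ; linearˡ = λ y → linearˡ (π a y)
      ; linearʳ = λ x → compose (π-linear a) (linearʳ x)
      }
    ; ⊢-bilinear  = λ a → let open IsBilinear (⋆-bilinear a) in record
      { ∙-cong  = λ x≈x′ y≈y′ → ∙-cong (π-cong a x≈x′) y≈y′
      ; linearˡ = λ y → compose (π-linear a) (linearˡ y)
      ; linearʳ = λ x → linearʳ (π a x)
      }
    ; ⊢-⊣         = λ a a′ x y z → ⋆-⊢⊣ a a′ (π a′ x) y (π a z)
    ; ⊣-⊢         = λ a a′ x y z → begin
        (x ⋆[ a ↑ a′ ] π (a ↑ a′) y) ⋆[ a ] π a z
          ≈⟨ ⋆-⊣⊢ a a′ x (π (a ↑ a′) y) (π a z) ⟩
        x ⋆[ a ] (π (a ↑ a′) y ⋆[ a′ ] π a z)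
          ≈⟨ ⋆-cong a ≈ᴹ-refl (⋆-cong a′ (π-∘ a a′ y) ≈ᴹ-refl) ⟨
        x ⋆[ a ] (π a (π a′ y) ⋆[ a′ ] π a z)
          ≈⟨ ⋆-cong a ≈ᴹ-refl (π-⋆ a a′ (π a′ y) z) ⟨
        x ⋆[ a ] π a (π a′ y ⋆[ a′ ] z) ∎
    ; ⊢-↑         = λ a a′ x y z → begin
        π a (x ⋆[ a′ ] π a′ y) ⋆[ a ] z
          ≈⟨ ⋆-cong a (π-⋆ a a′ x (π a′ y)) ≈ᴹ-refl ⟩
        (π a x ⋆[ a′ ] π a (π a′ y)) ⋆[ a ] z
          ≈⟨ ⋆-cong a (⋆-cong a′ ≈ᴹ-refl (π-∘ a a′ y)) ≈ᴹ-refl ⟩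
        (π a x ⋆[ a′ ] π (a ↑ a′) y) ⋆[ a ] z
          ≈⟨ ⋆-⊢↑ a a′ (π a x) (π (a ↑ a′) y) z ⟩
        π a x ⋆[ a ] (π (a ↑ a′) y ⋆[ a ↑ a′ ] z) ∎
    ; ⊣-⊣         = λ a a′ x y z → begin
        (x ⋆[ a ] π a y) ⋆[ a ↑ a′ ] π (a ↑ a′) z
          ≈⟨ ⋆-⊣⊣ a a′ x (π a y) (π (a ↑ a′) z) ⟩
        x ⋆[ a ] (π a y ⋆[ a′ ] π (a ↑ a′) z)
          ≈⟨ ⋆-cong a ≈ᴹ-refl (⋆-cong a′ ≈ᴹ-refl (π-∘ a a′ z)) ⟨
        x ⋆[ a ] (π a y ⋆[ a′ ] π a (π a′ z))
          ≈⟨ ⋆-cong a ≈ᴹ-refl (π-⋆ a a′ y (π a′ z)) ⟨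
        x ⋆[ a ] π a (y ⋆[ a′ ] π a′ z) ∎
    ; ⊢-⊢         = λ a a′ x y z → begin
        π a (π a′ x ⋆[ a′ ] y) ⋆[ a ] z
          ≈⟨ ⋆-cong a (π-⋆ a a′ (π a′ x) y) ≈ᴹ-refl ⟩
        (π a (π a′ x) ⋆[ a′ ] π a y) ⋆[ a ] z
          ≈⟨ ⋆-cong a (⋆-cong a′ (π-∘ a a′ x) ≈ᴹ-refl) ≈ᴹ-refl ⟩
        (π (a ↑ a′) x ⋆[ a′ ] π a y) ⋆[ a ] z
          ≈⟨ ⋆-⊢⊢ a a′ (π (a ↑ a′) x) (π a y) z ⟩
        π (a ↑ a′) x ⋆[ a ↑ a′ ] (π a y ⋆[ a ] z) ∎
    }

{-# OPTIONS --safe #-}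

-- For a ∈ [h], 𝟏 is a unit of ⋆ₐ fixed by π_a, so an element e is an
-- a-bar-unit of M(𝓜) if and only if π_a e = 𝟏; then, for b ∈ [a, h],
-- π_b e = π_b (π_a e) = 𝟏. Hence every e ∈ Halo_a satisfies
-- x ⊣_b e = x = e ⊢_b x, and the span of Halo_a is stable under ⊣_b and ⊢_b
-- by linearity in the argument carrying the projection.
module Submission where

open import Defs
open import Level using (Level)
open import Algebra.Apartness.Bundles using (HeytingField)
open import Algebra.Bundles using (CommutativeRing)
import Algebra.Definitions.RawMonoid as RawMonoidDefinitions
open import Algebra.Module.Bundles using (Module)
open import Algebra.Module.Morphism.Structures using (module ModuleMorphisms)
open import Data.Bool.Base using (true; false)
open import Data.Fin.Base using (Fin; zero; suc; toℕ; _≤_)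
open import Data.Fin.Properties using (≤-total)
open import Data.Fin.Subset using (Subset; ∣_∣; _∈_)
open import Data.Nat.Base as ℕ using (ℕ; _+_; _∸_; s≤s)
import Data.Nat.Properties as ℕ
open import Data.Product.Base using (_×_; _,_; proj₁; proj₂)
open import Data.Sum.Base using (inj₁; inj₂)
open import Data.Vec.Base using (_∷_; here; there)
open import Data.Vec.Functional as Vector using (Vector)
open import Data.Vec.Properties using ([]=⇒lookup; lookup∘tabulate)
open import Function.Base using (_∘_)
open import Function.Bundles using (_⇔_; mk⇔)
open import Relation.Binary.PropositionalEquality as ≡ using (_≡_; refl)
import Relation.Binary.Reasoning.Setoid as SetoidReasoning
open import Relation.Nullary.Decidable using (Dec; does; proof; _×-dec_)
open import Relation.Nullary.Negation using (contradiction)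
open import Relation.Nullary.Reflects using (Reflects; invert)
open import Relation.Unary using (Pred; _⊆_; _⊢_)
open PluriassociativeAlgebra using (IsBarUnit; IsWireUnit; Halo; IsSubalgebra)

private
  variable
    c ℓ₁ ℓ₂ m ℓm p q : Level
    γ : ℕ

-- Intervals of indices

enumerate-∈ : (C : Subset γ) (i : Fin ∣ C ∣) → enumerate C i ∈ C
enumerate-∈ (true  ∷ C) zero    = here
enumerate-∈ (true  ∷ C) (suc i) = there (enumerate-∈ C i)
enumerate-∈ (false ∷ C) i       = there (enumerate-∈ C i)

does≡true⇒ : {A : Set p} (a? : Dec A) → does a? ≡ true → A
does≡true⇒ a? eq = invert (≡.subst (Reflects _) eq (proof a?))

∈interval⇒ : ∀ {a b} {i : Fin γ} → i ∈ interval a b →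
             a ℕ.≤ index i × index i ℕ.≤ b
∈interval⇒ {a = a} {b} {i} i∈ = does≡true⇒
  ((a ℕ.≤? index i) ×-dec (index i ℕ.≤? b))
  (≡.trans (≡.sym (lookup∘tabulate _ i)) ([]=⇒lookup i∈))

-- The tail of interval (ℕ.suc a) (ℕ.suc b) reduces to interval a b, or to
-- interval 1 b if a = 0; so {1} ⊆ [γ + 1] has interval 1 0 as its tail.
∣interval-1-0∣≡0 : ∀ γ → ∣ interval {γ} 1 0 ∣ ≡ 0
∣interval-1-0∣≡0 ℕ.zero    = refl
∣interval-1-0∣≡0 (ℕ.suc γ) = ∣interval-1-0∣≡0 γ

-- Dropping the first index of `[γ]` lowers both bounds by one, until the lower bound is 1; from
-- then on each dropped index is counted and only the upper bound decreases.
∣interval∣ : {a b : Fin γ} → a ≤ b →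
             ∣ interval {γ} (index a) (index b) ∣ ≡ (toℕ b ∸ toℕ a) + 1
∣interval∣ {ℕ.suc γ}         {zero}  {zero}  _         =
  ≡.cong ℕ.suc (∣interval-1-0∣≡0 γ)
∣interval∣ {ℕ.suc (ℕ.suc γ)} {zero}  {suc b} _         =
  ≡.cong ℕ.suc (∣interval∣ {a = zero} {b} ℕ.z≤n)
∣interval∣ {_}               {suc a} {suc b} (s≤s a≤b) = ∣interval∣ a≤b

-- Linear spans

module _ {R : CommutativeRing c ℓ₁} (V : Module R m ℓm) where

  open CommutativeRing R using (Carrier; _*_)
  open Module V
  open SetoidReasoning ≈ᴹ-setoid

  module _ (S : Pred Carrierᴹ p) where

    0ᴹ∈Span : Span V S 0ᴹ
    0ᴹ∈Span = 0 , (λ ()) , (λ ()) , (λ ()) , ≈ᴹ-refl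

    Span-resp-≈ : ∀ {x y} → x ≈ᴹ y → Span V S x → Span V S y
    Span-resp-≈ x≈y (n , k , v , v∈S , x≈Σ) =
      n , k , v , v∈S , ≈ᴹ-trans (≈ᴹ-sym x≈y) x≈Σ

    *ₗ+ᴹ∈Span : ∀ r {x y} → S x → Span V S y → Span V S (r *ₗ x +ᴹ y)
    *ₗ+ᴹ∈Span r {x} x∈S (n , k , v , v∈S , y≈Σ) =
      ℕ.suc n , r Vector.∷ k , x Vector.∷ v ,
      (λ { zero → x∈S ; (suc i) → v∈S i }) , +ᴹ-congˡ y≈Σ

    -- A linear combination is built from `0ᴹ` by adding one scaled generator at a time. Inducting
    -- on this avoids concatenating families of coefficients and vectors.
    Span-ind : (P : Pred Carrierᴹ q) →
               (∀ {x y} → x ≈ᴹ y → P x → P y) → P 0ᴹ →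
               (∀ r {x y} → S x → P y → P (r *ₗ x +ᴹ y)) → Span V S ⊆ P
    Span-ind P P-resp P0 P+ (n , k , v , v∈S , x≈Σ) =
      P-resp (≈ᴹ-sym x≈Σ) (go n k v v∈S)
      where
      open RawMonoidDefinitions +ᴹ-rawMonoid using (sum)

      go : ∀ n (k : Vector Carrier n) (v : Vector Carrierᴹ n) → (∀ i → S (v i)) →
           P (sum (λ i → k i *ₗ v i))
      go ℕ.zero    k v v∈S = P0
      go (ℕ.suc n) k v v∈S =
        P+ (k zero) (v∈S zero) (go n (k ∘ suc) (v ∘ suc) (v∈S ∘ suc))

    Span-isSubspace : IsSubspace V (Span V S)
    Span-isSubspace = record
      { resp-≈ = Span-resp-≈
      ; 0ᴹ∈    = 0ᴹ∈Span
      -- Induction on `x` with `y` fixed: the terms of `x` are prepended one by one to the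
      -- combination for `y`.
      ; +ᴹ∈    = λ {x} {y} x∈ y∈ → Span-ind
          (λ z → Span V S (z +ᴹ y))
          (λ z≈z′ → Span-resp-≈ (+ᴹ-congʳ z≈z′))
          (Span-resp-≈ (≈ᴹ-sym (+ᴹ-identityˡ y)) y∈)
          (λ r s∈S z+y∈ → Span-resp-≈ (≈ᴹ-sym (+ᴹ-assoc _ _ y))
                            (*ₗ+ᴹ∈Span r s∈S z+y∈))
          x∈
      ; *ₗ∈    = λ k → Span-ind
          (λ z → Span V S (k *ₗ z))
          (λ z≈z′ → Span-resp-≈ (*ₗ-congˡ z≈z′))
          (Span-resp-≈ (≈ᴹ-sym (*ₗ-zeroʳ k)) 0ᴹ∈Span)
          (λ r {s} {z} s∈S kz∈ → Span-resp-≈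
            (begin
              (k * r) *ₗ s +ᴹ k *ₗ z   ≈⟨ +ᴹ-congʳ (*ₗ-assoc k r s) ⟩
              k *ₗ r *ₗ s +ᴹ k *ₗ z    ≈⟨ *ₗ-distribˡ k (r *ₗ s) z ⟨
              k *ₗ (r *ₗ s +ᴹ z)       ∎)
            (*ₗ+ᴹ∈Span (k * r) s∈S kz∈))
      }

    Span-least : {T : Pred Carrierᴹ q} → IsSubspace V T → S ⊆ T → Span V S ⊆ T
    Span-least T-isSubspace S⊆T =
      Span-ind _ resp-≈ 0ᴹ∈ (λ r s∈S → +ᴹ∈ (*ₗ∈ r (S⊆T s∈S)))
      where open IsSubspace T-isSubspace

  -- Here `f ⊢ T` is the preimage of `T` under `f`, not a pluriassociative product. With
  -- `Span-least`, it reduces the stability of a span under a linear map to the generators.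
  ⊢-isSubspace : ∀ {f} {T : Pred Carrierᴹ p} → IsLinear V f →
                 IsSubspace V T → IsSubspace V (f ⊢ T)
  ⊢-isSubspace f-linear T-isSubspace = record
    { resp-≈ = λ x≈y → resp-≈ (⟦⟧-cong x≈y)
    ; 0ᴹ∈    = resp-≈ (≈ᴹ-sym 0ᴹ-homo) 0ᴹ∈
    ; +ᴹ∈    = λ fx∈ fy∈ → resp-≈ (≈ᴹ-sym (+ᴹ-homo _ _)) (+ᴹ∈ fx∈ fy∈)
    ; *ₗ∈    = λ k fx∈ → resp-≈ (≈ᴹ-sym (*ₗ-homo k _)) (*ₗ∈ k fx∈)
    }
    where
    open ModuleMorphisms.IsModuleHomomorphism f-linear
    open IsSubspace T-isSubspace

-- Units of multiassociative algebras

module _ {K : HeytingField c ℓ₁ ℓ₂}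
         (𝓐 : MultiassociativeAlgebra K γ m ℓm) where

  open MultiassociativeAlgebra 𝓐
  open SetoidReasoning ≈ᴹ-setoid

  -- Expanding `x` as `e ⋆[ b ] x` or `x ⋆[ b ] e` brings in the index `b`; multiassociativity then
  -- turns the remaining `a` into `b`.
  IsUnitAt-≤ : ∀ {a b e} → a ≤ b → IsUnitAt b e → IsUnitAt a e
  IsUnitAt-≤ {a} {b} {e} a≤b e-unit x = left , right
    where
    left : e ⋆[ a ] x ≈ᴹ x
    left = begin
      e ⋆[ a ] x              ≈⟨ ⋆-cong a ≈ᴹ-refl (proj₁ (e-unit x)) ⟨
      e ⋆[ a ] (e ⋆[ b ] x)   ≈⟨ ⋆-assoc₃ a≤b ℕ.≤-refl e e x ⟩
      e ⋆[ b ] (e ⋆[ b ] x)   ≈⟨ proj₁ (e-unit _) ⟩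
      e ⋆[ b ] x              ≈⟨ proj₁ (e-unit x) ⟩
      x                       ∎

    right : x ⋆[ a ] e ≈ᴹ x
    right = begin
      x ⋆[ a ] e              ≈⟨ ⋆-cong a (proj₂ (e-unit x)) ≈ᴹ-refl ⟨
      (x ⋆[ b ] e) ⋆[ a ] e   ≈⟨ ⋆-assoc₁ ℕ.≤-refl a≤b x e e ⟨
      (x ⋆[ b ] e) ⋆[ b ] e   ≈⟨ proj₂ (e-unit _) ⟩
      x ⋆[ b ] e              ≈⟨ proj₂ (e-unit x) ⟩
      x                       ∎

  IsUnitAt-unique : ∀ {a e e′} → IsUnitAt a e → IsUnitAt a e′ → e ≈ᴹ e′
  IsUnitAt-unique {e = e} {e′} e-unit e′-unit =
    ≈ᴹ-trans (≈ᴹ-sym (proj₂ (e′-unit e))) (proj₁ (e-unit e′))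

  IsUnit-unique : ∀ {e e′} → IsUnit e → IsUnit e′ → e ≈ᴹ e′
  IsUnit-unique (a , e-unit) (b , e′-unit) with ≤-total a b
  ... | inj₁ a≤b = IsUnitAt-unique e-unit (IsUnitAt-≤ a≤b e′-unit)
  ... | inj₂ b≤a = IsUnitAt-unique (IsUnitAt-≤ b≤a e-unit) e′-unit

  IsUnitAt-resp-≈ : ∀ {a e e′} → e ≈ᴹ e′ → IsUnitAt a e → IsUnitAt a e′
  IsUnitAt-resp-≈ {a} e≈e′ e-unit x =
    ≈ᴹ-trans (⋆-cong a (≈ᴹ-sym e≈e′) ≈ᴹ-refl) (proj₁ (e-unit x)) ,
    ≈ᴹ-trans (⋆-cong a ≈ᴹ-refl (≈ᴹ-sym e≈e′)) (proj₂ (e-unit x))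

  -- The height comes with its own unit, while `e` is a unit at some unspecified index; uniqueness
  -- identifies the two, so `e` is a unit at the height and hence below it.
  IsUnit⇒IsUnitAt : ∀ {h e a} → HasHeight h → IsUnit e → index a ℕ.≤ h →
                    IsUnitAt a e
  IsUnit⇒IsUnitAt (no-unit ¬unit)    e-unit _         =
    contradiction e-unit (¬unit _)
  IsUnit⇒IsUnitAt (unit h e′-unit _) e-unit (s≤s a≤h) = IsUnitAt-≤ a≤h
    (IsUnitAt-resp-≈ (IsUnit-unique (h , e′-unit) e-unit) e′-unit)

-- Bar-units, halos and wire-units of `M 𝓜`

module _ {K : HeytingField c ℓ₁ ℓ₂} (𝓜 : MultiprojectionAlgebra K γ m ℓm) where

  open MultiprojectionAlgebra 𝓜
  open SetoidReasoning ≈ᴹ-setoid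

  module _ {h 𝟏} (𝓜-unital : IsUnital h 𝟏) where

    open IsUnital 𝓜-unital

    𝟏-isUnitAt : ∀ {a} → index a ℕ.≤ h → IsUnitAt a 𝟏
    𝟏-isUnitAt = IsUnit⇒IsUnitAt multiassociativeAlgebra hasHeight isUnit

    π≈𝟏⇒IsBarUnit : ∀ {a e} → index a ℕ.≤ h → π a e ≈ᴹ 𝟏 → IsBarUnit (M 𝓜) a e
    π≈𝟏⇒IsBarUnit {a} a≤h πe≈𝟏 x =
      ≈ᴹ-trans (⋆-cong a ≈ᴹ-refl πe≈𝟏) (proj₂ (𝟏-isUnitAt a≤h x)) ,
      ≈ᴹ-trans (⋆-cong a πe≈𝟏 ≈ᴹ-refl) (proj₁ (𝟏-isUnitAt a≤h x))

    IsBarUnit⇒π≈𝟏 : ∀ {a e} → index a ℕ.≤ h → IsBarUnit (M 𝓜) a e → π a e ≈ᴹ 𝟏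
    IsBarUnit⇒π≈𝟏 a≤h e-bar =
      -- The bar-unit law is tested at `𝟏`, where `𝟏 ⊣[ a ] e` is `𝟏 ⋆[ a ] π a e`, that is,
      -- `π a e`.
      ≈ᴹ-trans (≈ᴹ-sym (proj₁ (𝟏-isUnitAt a≤h _))) (proj₁ (e-bar 𝟏))

    𝟏-isBarUnit : ∀ {a} → index a ℕ.≤ h → IsBarUnit (M 𝓜) a 𝟏
    𝟏-isBarUnit a≤h = π≈𝟏⇒IsBarUnit a≤h (π-unit _ a≤h)

    Halo-mono : ∀ {a b} → a ≤ b → index b ℕ.≤ h → Halo (M 𝓜) a ⊆ Halo (M 𝓜) b
    Halo-mono {a} {b} a≤b b≤h {e} e-bar = π≈𝟏⇒IsBarUnit b≤h (begin
      π b e         ≡⟨ ≡.cong (λ d → π d e) (≤⇒↑≡ˡ a≤b) ⟨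
      π (b ↑ a) e   ≈⟨ π-∘ b a e ⟨
      π b (π a e)   ≈⟨ ⟦⟧-cong (IsBarUnit⇒π≈𝟏 (ℕ.≤-trans (s≤s a≤b) b≤h) e-bar) ⟩
      π b 𝟏         ≈⟨ π-unit b b≤h ⟩
      𝟏             ∎)
      where open ModuleMorphisms.IsModuleHomomorphism (π-linear b)

    Span-Halo-isSubalgebra :
      ∀ {a} → IsSubalgebra (induced (M 𝓜) (interval (index a) h))
                (Span vectorSpace (Halo (M 𝓜) a))
    Span-Halo-isSubalgebra {a} = record
      { isSubspace = Span-isSubspace vectorSpace Haloₐ
      -- For fixed `x` in the span, the `y` whose product with `x` stays in the span form a
      -- subspace. It contains the halo, since there the product is `x` itself.
      ; ⊣∈ = λ i {x} x∈ → Span-least vectorSpace Haloₐ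
          (⊢-isSubspace vectorSpace
            (IsBilinear.linearʳ (⊣-bilinear (# i)) x) (Span-isSubspace vectorSpace Haloₐ))
          (λ e-bar → Span-resp-≈ vectorSpace Haloₐ
            (≈ᴹ-sym (proj₁ (Haloₐ⊆ i e-bar x))) x∈)
      -- The projection now falls on the left factor, so `y` is fixed and `x` varies.
      ; ⊢∈ = λ i {_} {y} x∈ y∈ → Span-least vectorSpace Haloₐ
          (⊢-isSubspace vectorSpace
            (IsBilinear.linearˡ (⊢-bilinear (# i)) y) (Span-isSubspace vectorSpace Haloₐ))
          (λ e-bar → Span-resp-≈ vectorSpace Haloₐ
            (≈ᴹ-sym (proj₂ (Haloₐ⊆ i e-bar y))) y∈)
          x∈
      }
      where
      open PluriassociativeAlgebra (M 𝓜) using (⊣-bilinear; ⊢-bilinear)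

      Haloₐ : Pred Carrierᴹ _
      Haloₐ = Halo (M 𝓜) a

      C : Subset γ
      C = interval (index a) h

      # : Fin ∣ C ∣ → Fin γ
      # = enumerate C

      Haloₐ⊆ : ∀ i → Haloₐ ⊆ Halo (M 𝓜) (# i)
      Haloₐ⊆ i = let a≤i , i≤h = ∈interval⇒ (enumerate-∈ C i) in
        Halo-mono (ℕ.s≤s⁻¹ a≤i) i≤h

    -- Since `𝟏` is neutral for `⋆[ a ]`, both `𝟏 ⊣[ a ] x` and `x ⊢[ a ] 𝟏` equal `π a x`.
    π-identity⇔𝟏-isWireUnit : ∀ {a} → index a ℕ.≤ h →
                              (∀ x → π a x ≈ᴹ x) ⇔ IsWireUnit (M 𝓜) a 𝟏
    π-identity⇔𝟏-isWireUnit {a} a≤h = mk⇔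
      (λ π≈id x → ≈ᴹ-trans (𝟏⋆ (π a x)) (π≈id x) ,
                  ≈ᴹ-trans (⋆𝟏 (π a x)) (π≈id x))
      (λ 𝟏-wire x → ≈ᴹ-trans (≈ᴹ-sym (𝟏⋆ (π a x))) (proj₁ (𝟏-wire x)))
      where
      𝟏⋆ : ∀ x → 𝟏 ⋆[ a ] x ≈ᴹ x
      𝟏⋆ x = proj₁ (𝟏-isUnitAt a≤h x)

      ⋆𝟏 : ∀ x → x ⋆[ a ] 𝟏 ≈ᴹ x
      ⋆𝟏 x = proj₂ (𝟏-isUnitAt a≤h x)

-- As `interval` is cut off at `γ`, the count relies on `h` being at most `γ`: a positive height is
-- the `index` of an element of `Fin γ`, and height 0 is excluded by `index a ℕ.≤ h`.
∣interval-height∣ :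
  {K : HeytingField c ℓ₁ ℓ₂} (𝓐 : MultiassociativeAlgebra K γ m ℓm) →
  ∀ {h} {a : Fin γ} → MultiassociativeAlgebra.HasHeight 𝓐 h → index a ℕ.≤ h →
  ∣ interval {γ} (index a) h ∣ ≡ (h ∸ index a) + 1
∣interval-height∣ 𝓐 (MultiassociativeAlgebra.unit h _ _) (s≤s a≤h) =
  ∣interval∣ a≤h

proposition3p3p3 :
    ∀ {c ℓ₁ ℓ₂ m ℓm} (K : HeytingField c ℓ₁ ℓ₂) → CharacteristicZero K →
    (γ : ℕ) (𝓜 : MultiprojectionAlgebra K γ m ℓm) →
    let open MultiprojectionAlgebra 𝓜 in
    (h : ℕ) (𝟏 : Carrierᴹ) → IsUnital h 𝟏 →
      (∀ (a : Fin γ) → index a ℕ.≤ h → IsBarUnit (M 𝓜) a 𝟏)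
    × (∀ (a b : Fin γ) → a ≤ b → index b ℕ.≤ h → Halo (M 𝓜) a ⊆ Halo (M 𝓜) b)
    × (∀ (a : Fin γ) → index a ℕ.≤ h →
         let C = interval (index a) h in
           ∣ C ∣ ≡ (h ∸ index a) + 1
         × IsSubalgebra (induced (M 𝓜) C) (Span vectorSpace (Halo (M 𝓜) a)))
    × (∀ (a : Fin γ) → index a ℕ.≤ h →
         (∀ x → π a x ≈ᴹ x) ⇔ IsWireUnit (M 𝓜) a 𝟏)
proposition3p3p3 K _ γ 𝓜 h 𝟏 𝓜-unital =
    (λ a → 𝟏-isBarUnit 𝓜 𝓜-unital {a})
  , (λ a b → Halo-mono 𝓜 𝓜-unital {a} {b})
  , (λ a a≤h → ∣interval-height∣ multiassociativeAlgebra {h} {a} hasHeight a≤h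
             , Span-Halo-isSubalgebra 𝓜 𝓜-unital {a})
  , (λ a → π-identity⇔𝟏-isWireUnit 𝓜 𝓜-unital {a})
  where
  open MultiprojectionAlgebra 𝓜
  open IsUnital 𝓜-unital using (hasHeight)
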